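{- Let $\lambda\ge\kappa$ be infinite cardinals, let $P$ and $Q$ be partial orders such that $P$ has the $(\lambda,\kappa)$-FN, and let $i\colon P\to Q$ and $j\colon Q\to P$ be order-preserving maps such that $i\circ j=\mathrm{id}_Q$. Then $Q$ also has the $(\lambda,\kappa)$-FN. In particular, every retract (in the category of boolean algebras) of a boolean algebra with the $(\lambda,\kappa)$-FN has the $(\lambda,\kappa)$-FN.
   Context: For infinite cardinals $\lambda\ge\kappa$, a partial order $P$ has the $(\lambda,\kappa)$-FN iff there is a map $(f,g)\colon P\to[P]^{<\lambda}\times[P]^{<\kappa}$ such that for all $p\le q$ in $P$ there exist $r\in f(p)\cap g(q)$ with $p\le r\le q$ and $s\in g(p)\cap f(q)$ with $p\le s\le q$. Here $[P]^{<\mu}$ is the set of subsets of $P$ of cardinality less than $\mu$. A boolean algebra has the $(\lambda,\kappa)$-FN iff its underlying partial order does. -}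

-- Sets are setoids, and the universe of sets is the one at level ℓ: all orders,
-- algebras, cardinals and subsets below live there.

module Defs where

open import Algebra.Lattice.Bundles using (BooleanAlgebra)
open import Algebra.Lattice.Morphism.Structures using (module LatticeMorphisms)
import Algebra.Lattice.Properties.Lattice as LatticeProperties
import Algebra.Morphism.Definitions as MorphismDefinitions
open import Data.Nat.Base using (ℕ)
open import Data.Product.Base using (∃-syntax; Σ-syntax; _×_; proj₁; proj₂; swap; _,_)
open import Data.Product.Relation.Binary.Pointwise.NonDependent using (_×ₛ_)
open import Function.Base using (_∘_)
open import Function.Bundles using (Func; Injection)
open import Induction.WellFounded using (WellFounded)
open import Level using (Level; _⊔_; suc)
open import Relation.Binary.Bundles using (Setoid; Poset; StrictTotalOrder)
open import Relation.Binary.Definitions using (_Respects_)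
import Relation.Binary.Construct.On as On
open import Relation.Binary.PropositionalEquality.Properties using (setoid)
open import Relation.Nullary.Negation.Core using (¬_)
open import Relation.Unary using (Pred; _≐_)

private
  variable
    a b c d ℓ : Level

infix 4 _≼_ _≺_ _≤ᶜ_

_≼_ : Setoid a b → Setoid c d → Set (a ⊔ b ⊔ c ⊔ d)
S ≼ T = Injection S T

_≺_ : Setoid a b → Setoid c d → Set (a ⊔ b ⊔ c ⊔ d)
S ≺ T = S ≼ T × ¬ (T ≼ S)

-- A predicate seen as a set in its own right: two elements are equal when they
-- are equal in S, whatever their membership proofs.
⟪_∣_⟫ : (S : Setoid a b) → Pred (Setoid.Carrier S) c → Setoid (a ⊔ c) b
⟪ S ∣ U ⟫ = On.setoid S (proj₁ {B = U})

-- Infinite cardinals are infinite initial ordinals: infinite well-orders that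
-- are strictly larger than each of their proper initial segments.
record InfiniteCardinal ℓ : Set (suc ℓ) where
  field
    order : StrictTotalOrder ℓ ℓ ℓ

  open StrictTotalOrder order public using (Carrier; _<_)

  set : Setoid ℓ ℓ
  set = StrictTotalOrder.Eq.setoid order

  field
    <-wellFounded : WellFounded _<_
    initial       : ∀ x → ⟪ set ∣ (_< x) ⟫ ≺ set
    infinite      : setoid ℕ ≼ set

_≤ᶜ_ : InfiniteCardinal ℓ → InfiniteCardinal ℓ → Set ℓ
κ ≤ᶜ μ = InfiniteCardinal.set κ ≼ InfiniteCardinal.set μ

record SmallSubset (S : Setoid ℓ ℓ) (μ : InfiniteCardinal ℓ) : Set (suc ℓ) where
  open Setoid S using (_≈_) renaming (Carrier to X)
  field
    member : Pred X ℓ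
    resp   : member Respects _≈_
    small  : ⟪ S ∣ member ⟫ ≺ InfiniteCardinal.set μ

open SmallSubset public using (member)

-- [ S ]^< μ, with extensional equality of subsets
[_]^<_ : Setoid ℓ ℓ → InfiniteCardinal ℓ → Setoid (suc ℓ) ℓ
[ S ]^< μ = record
  { Carrier       = SmallSubset S μ
  ; _≈_           = λ U V → member U ≐ member V
  ; isEquivalence = record
    { refl  = (λ x∈U → x∈U) , (λ x∈U → x∈U)
    ; sym   = swap
    ; trans = λ (U⊆V , V⊆U) (V⊆W , W⊆V) → (V⊆W ∘ U⊆V) , (V⊆U ∘ W⊆V)
    }
  }

FN : InfiniteCardinal ℓ → InfiniteCardinal ℓ → Poset ℓ ℓ ℓ → Set (suc ℓ)
FN μ κ P =
  Σ[ fg ∈ Func |P| (([ |P| ]^< μ) ×ₛ ([ |P| ]^< κ)) ]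
    let f = λ p → member (proj₁ (Func.to fg p))
        g = λ p → member (proj₂ (Func.to fg p))
    in ∀ p q → p ≤ q →
         (∃[ r ] (f p r × g q r) × (p ≤ r × r ≤ q)) ×
         (∃[ s ] (g p s × f q s) × (p ≤ s × s ≤ q))
  where
  open Poset P using (_≤_)
  |P| = Poset.Eq.setoid P

-- x ≤ y means x ≈ x ∧ y
≤-poset : BooleanAlgebra ℓ ℓ → Poset ℓ ℓ ℓ
≤-poset A = LatticeProperties.poset (BooleanAlgebra.lattice A)

record BooleanHomomorphism (A B : BooleanAlgebra ℓ ℓ) : Set ℓ where
  private
    module A = BooleanAlgebra A
    module B = BooleanAlgebra B
  open MorphismDefinitions A.Carrier B.Carrier B._≈_ using (Homomorphic₀; Homomorphic₁)
  open LatticeMorphisms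
    (BooleanAlgebra.rawLattice A) (BooleanAlgebra.rawLattice B) using (IsLatticeHomomorphism)
  field
    ⟦_⟧                   : A.Carrier → B.Carrier
    isLatticeHomomorphism : IsLatticeHomomorphism ⟦_⟧
    ¬-homo                : Homomorphic₁ ⟦_⟧ A.¬_ B.¬_
    ⊤-homo                : Homomorphic₀ ⟦_⟧ A.⊤ B.⊤
    ⊥-homo                : Homomorphic₀ ⟦_⟧ A.⊥ B.⊥

record _IsRetractOf_ (B A : BooleanAlgebra ℓ ℓ) : Set ℓ where
  open BooleanAlgebra B using (_≈_)
  field
    retraction : BooleanHomomorphism A B
    section    : BooleanHomomorphism B A
    retracts   : ∀ x → BooleanHomomorphism.⟦_⟧ retraction
                         (BooleanHomomorphism.⟦_⟧ section x) ≈ x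

{-# OPTIONS --safe #-}

-- The maps q ↦ i[f(j q)] and q ↦ i[g(j q)] witness the property for Q: an
-- element r interpolating j p ≤ j q is sent by i to one interpolating p ≤ q.
-- That i[U] is no larger than U needs no axiom of choice: U embeds into a
-- well-order, so every point of i[U] has a least preimage in U.

module Submission where

open import Defs
open import Algebra.Lattice.Bundles using (BooleanAlgebra)
open import Axiom.ExcludedMiddle using (ExcludedMiddle)
open import Data.Product.Base using (_×_)
open import Relation.Binary.Bundles using (Poset)
open import Relation.Binary.Morphism.Bundles using (PosetHomomorphism)

open import Algebra.Lattice.Morphism.Structures using (module LatticeMorphisms)
open import Data.Product.Base using (∃; ∃-syntax; _,_; proj₁; proj₂)
open import Function.Base using (_on_)
open import Function.Bundles using (Func; Injection)
import Function.Construct.Composition as Composition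
open import Induction.WellFounded using (WellFounded; Acc; acc)
open import Level using (Level)
open import Relation.Binary.Bundles using (Setoid; StrictTotalOrder)
import Relation.Binary.Construct.On as On
open import Relation.Binary.Core using (Rel)
open import Relation.Binary.Definitions using (tri<; tri≈; tri>)
open import Relation.Binary.Morphism.Structures using (IsOrderHomomorphism)
open import Relation.Nullary.Decidable.Core using (yes; no)
open import Relation.Nullary.Negation.Core using (¬_; contradiction)
open import Relation.Unary using (Pred; _≐_)

private
  variable
    ℓ : Level

Minimal : {A : Set ℓ} → Rel A ℓ → Pred A ℓ → Pred A ℓ
Minimal _<_ P x = P x × (∀ y → P y → ¬ (y < x))

-- Descend from the given element: excluded middle decides whether `P` holds somewhere strictly
-- below, and accessibility makes the descent stop.
∃-minimal : ExcludedMiddle ℓ → {A : Set ℓ} {_<_ : Rel A ℓ} → WellFounded _<_ →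
            (P : Pred A ℓ) → ∃ P → ∃ (Minimal _<_ P)
∃-minimal em {_<_ = _<_} wf P (x , Px) = go x (wf x) Px
  where
  go : ∀ x → Acc _<_ x → P x → ∃ (Minimal _<_ P)
  go x (acc rs) Px with em {∃[ y ] P y × y < x}
  ... | yes (y , Py , y<x) = go y (rs y<x) Py
  ... | no  ∄y             = x , Px , λ y Py y<x → ∄y (y , Py , y<x)

-- Membership asks for `h x` only up to the equality of `T`, so the image is closed under that
-- equality.
Image : {S T : Setoid ℓ ℓ} → Func S T → Pred (Setoid.Carrier S) ℓ →
        Pred (Setoid.Carrier T) ℓ
Image {T = T} h U y = ∃[ x ] U x × Func.to h x ≈ y
  where open Setoid T using (_≈_)

module _ (em : ExcludedMiddle ℓ) {S T : Setoid ℓ ℓ} (h : Func S T) (μ : InfiniteCardinal ℓ) where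

  private
    module T = Setoid T
    module μ = InfiniteCardinal μ
    open StrictTotalOrder μ.order using (compare)
    open Func h renaming (to to h₀; cong to h-cong)

  -- Injectivity is immediate, since `h` recovers a point from any of its preimages. The real
  -- obligation is `cong`: equal points may carry membership proofs naming different preimages, so
  -- the choice must not depend on the proof; hence the minimal preimage.
  image-≼ : (U : Pred (Setoid.Carrier S) ℓ) → ⟪ S ∣ U ⟫ ≼ μ.set →
            ⟪ T ∣ Image h U ⟫ ≼ ⟪ S ∣ U ⟫
  image-≼ U e = record
    { to        = λ y → proj₁ (choose y)
    ; cong      = λ {y} {y′} → unique (choose y) (choose y′)
    ; injective = λ {y} {y′} x≈x′ →
        T.trans (T.sym (proj₁ (proj₂ (choose y))))
          (T.trans (h-cong x≈x′) (proj₁ (proj₂ (choose y′))))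
    }
    where
    module e = Injection e
    _⊏_ : Rel (∃ U) ℓ
    _⊏_ = μ._<_ on e.to

    -- Indexed by the bare point, so the preimage stored in a membership proof only starts the
    -- search for a minimal one.
    Preimage : T.Carrier → Pred (∃ U) ℓ
    Preimage y (x , _) = h₀ x T.≈ y

    choose : (y : ∃ (Image h U)) → ∃ (Minimal _⊏_ (Preimage (proj₁ y)))
    choose (y , x , x∈U , hx≈y) =
      ∃-minimal em (On.wellFounded e.to μ.<-wellFounded) (Preimage y) ((x , x∈U) , hx≈y)

    -- As `y ≈ y′`, each of the two elements is a preimage of both points, so neither can lie
    -- strictly below the other. Trichotomy in `μ` leaves equal values under `e`, and `e` is
    -- injective.
    unique : ∀ {y y′} (m : ∃ (Minimal _⊏_ (Preimage y))) (m′ : ∃ (Minimal _⊏_ (Preimage y′))) →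
             y T.≈ y′ → Setoid._≈_ ⟪ S ∣ U ⟫ (proj₁ m) (proj₁ m′)
    unique (x , hx≈y , x-min) (x′ , hx′≈y′ , x′-min) y≈y′
      with compare (e.to x) (e.to x′)
    ... | tri< x⊏x′ _ _ = contradiction x⊏x′ (x′-min x (T.trans hx≈y y≈y′))
    ... | tri≈ _ ex≈ex′ _ = e.injective ex≈ex′
    ... | tri> _ _ x′⊏x = contradiction x′⊏x (x-min x′ (T.trans hx′≈y′ (T.sym y≈y′)))

  image : SmallSubset S μ → SmallSubset T μ
  image U = record
    { member = Image h (member U)
    ; resp   = λ y≈y′ (x , x∈U , hx≈y) → x , x∈U , T.trans hx≈y y≈y′
    ; small  = Composition.injection h[U]≼U U≼μ
             -- Strictness passes to the image: an embedding of `μ` into `h[U]` would continue into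
             -- `U`.
             , λ μ≼h[U] → μ⋠U (Composition.injection μ≼h[U] h[U]≼U)
    }
    where
    U≼μ = proj₁ (SmallSubset.small U)
    μ⋠U = proj₂ (SmallSubset.small U)
    h[U]≼U = image-≼ (member U) U≼μ

  image-cong : ∀ {U V} → member U ≐ member V → member (image U) ≐ member (image V)
  image-cong (U⊆V , V⊆U) =
    (λ (x , x∈U , hx≈y) → x , U⊆V x∈U , hx≈y) , (λ (x , x∈V , hx≈y) → x , V⊆U x∈V , hx≈y)

FN-retract : ExcludedMiddle ℓ → (μ κ : InfiniteCardinal ℓ) (P Q : Poset ℓ ℓ ℓ) → FN μ κ P →
             (i : PosetHomomorphism P Q) (j : PosetHomomorphism Q P) →
             (∀ q → Poset._≈_ Q (PosetHomomorphism.⟦_⟧ i (PosetHomomorphism.⟦_⟧ j q)) q) →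
             FN μ κ Q
FN-retract em μ κ P Q (fg , interpolate) i j ij≈id = fg′ , interpolate′
  where
  module P = Poset P
  module Q = Poset Q
  module i = PosetHomomorphism i
  module j = PosetHomomorphism j
  module fg = Func fg

  iᶠ : Func P.Eq.setoid Q.Eq.setoid
  iᶠ = record { to = i.⟦_⟧ ; cong = i.cong }

  fg′ : Func Q.Eq.setoid _
  fg′ = record
    { to   = λ q → let U , V = fg.to j.⟦ q ⟧ in image em iᶠ μ U , image em iᶠ κ V
    ; cong = λ {q} {q′} q≈q′ →
        let U , V   = fg.to j.⟦ q ⟧
            U′ , V′ = fg.to j.⟦ q′ ⟧
            U≐ , V≐ = fg.cong (j.cong q≈q′)
        in image-cong em iᶠ μ {U} {U′} U≐ , image-cong em iᶠ κ {V} {V′} V≐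
    }

  -- Applying `i` bounds `i r` by `i (j p)` and `i (j q)`, which `ij≈id` identifies with `p` and
  -- `q`.
  between : ∀ {p q r} → j.⟦ p ⟧ P.≤ r × r P.≤ j.⟦ q ⟧ → p Q.≤ i.⟦ r ⟧ × i.⟦ r ⟧ Q.≤ q
  between {p} {q} (jp≤r , r≤jq) =
    Q.trans (Q.reflexive (Q.Eq.sym (ij≈id p))) (i.mono jp≤r) ,
    Q.trans (i.mono r≤jq) (Q.reflexive (ij≈id q))

  interpolate′ : ∀ p q → p Q.≤ q → _
  interpolate′ p q p≤q =
    let (r , (r∈f , r∈g) , r-between) , (s , (s∈g , s∈f) , s-between) =
          interpolate j.⟦ p ⟧ j.⟦ q ⟧ (j.mono p≤q)
    -- One preimage `r` puts `i r` in both images at once; likewise `s` for `i s`.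
    in (i.⟦ r ⟧ , ((r , r∈f , Q.Eq.refl) , (r , r∈g , Q.Eq.refl)) , between r-between)
     , (i.⟦ s ⟧ , ((s , s∈g , Q.Eq.refl) , (s , s∈f , Q.Eq.refl)) , between s-between)

-- The order is the equation `x ≈ x ∧ y`, which any map preserving meets and equality carries over.
posetHomomorphism : {A B : BooleanAlgebra ℓ ℓ} → BooleanHomomorphism A B →
                    PosetHomomorphism (≤-poset A) (≤-poset B)
posetHomomorphism {A = A} {B} h = record
  { ⟦_⟧                 = ⟦_⟧
  ; isOrderHomomorphism = record
    { cong = ⟦⟧-cong
    ; mono = λ {x} {y} x≈x∧y → B.trans (⟦⟧-cong x≈x∧y) (∧-homo x y)
    }
  }
  where
  module B = BooleanAlgebra B
  open BooleanHomomorphism h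
  open LatticeMorphisms.IsLatticeHomomorphism isLatticeHomomorphism
    using (∧-homo; ⟦⟧-cong)

theorem2p10 : ∀ {ℓ} → ExcludedMiddle ℓ →
    (μ κ : InfiniteCardinal ℓ) → κ ≤ᶜ μ →
    ((P Q : Poset ℓ ℓ ℓ) → FN μ κ P →
    (i : PosetHomomorphism P Q) (j : PosetHomomorphism Q P) →
    (∀ q → Poset._≈_ Q (PosetHomomorphism.⟦_⟧ i (PosetHomomorphism.⟦_⟧ j q)) q) →
    FN μ κ Q)
    ×
    ((A B : BooleanAlgebra ℓ ℓ) → FN μ κ (≤-poset A) → B IsRetractOf A →
    FN μ κ (≤-poset B))
theorem2p10 em μ κ _ =
  FN-retract em μ κ ,
  -- The retraction takes the place of `i` and the section that of `j`.
  λ A B fn B◁A → let open _IsRetractOf_ B◁A in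
    FN-retract em μ κ (≤-poset A) (≤-poset B) fn
      (posetHomomorphism retraction) (posetHomomorphism section) retracts
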